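{- Let $\Sigma=\{\sigma_1,\dots,\sigma_m\}$ be a finite alphabet of size $m$, let $h:\Sigma^*\to\Sigma^*$ be a morphism, and put $N=\max_{\sigma\in\Sigma}|h(\sigma)|$. Suppose that $h(\sigma_1)=\sigma_1x$ for some non-empty word $x\in\Sigma^*$, and that $|h(\sigma_i)|>1$ for each $i\in\{1,\dots,m\}$. Let $k\ge2$ and let $\mathcal{I}$ be a factor of $h^\omega(\sigma_1)$ which is an instance of a $k$-template $$t=[a_1,a_2,\dots,a_{k+1},d_1,d_2,\dots,d_{k-1}],$$ and suppose that $$|\mathcal{I}|>N+k-1+(k-1)\Bigl(N-2+\max_{1\le i<j\le k}\Bigl|\sum_{r=i}^{j-1}d_r\cdot(1,\dots,1)\Bigr|\Bigr).$$ Then, for some parent $t_1$ of $t$ under $h$, the infinite word $h^\omega(\sigma_1)$ contains a factor $\mathcal{J}$ which is an instance of $t_1$ and satisfies $|\mathcal{J}|<|\mathcal{I}|$.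
   Context: $\Sigma^*$ is the free monoid of finite words over $\Sigma$, with empty word $\epsilon$, and $|u|$ is the length of $u$; a morphism is a monoid homomorphism. $h^\omega(\sigma_1)$ is the infinite word having every $h^n(\sigma_1)$ as a prefix. A factor is a contiguous finite subword. The Parikh vector $\psi(u)\in\mathbb{N}^m$ (a row vector) has $i$-th coordinate the number of occurrences of $\sigma_i$ in $u$. The frequency matrix $M$ of $h$ is the $m\times m$ matrix whose $i$-th row is $\psi(h(\sigma_i))$. The symbol $\cdot$ is the dot product and $(1,\dots,1)\in\mathbb{Z}^m$. For $k\ge2$, a $k$-template is a finite sequence $t=[a_1,\dots,a_{k+1},d_1,\dots,d_{k-1}]$ with $a_i\in\Sigma\cup\{\epsilon\}$ and $d_j\in\mathbb{Z}^m$. A word $w$ is an instance (realization) of $t$ if there are words $X_1,\dots,X_k\in\Sigma^*$ with $w=a_1X_1a_2X_2\cdots a_kX_ka_{k+1}$ and $\psi(X_{i+1})-\psi(X_i)=d_i$ for $i=1,\dots,k-1$. A parent of $t$ under $h$ is a $k$-template $t_p=[A_1,\dots,A_{k+1},D_1,\dots,D_{k-1}]$ such that there are words $p_i',p_i''\in\Sigma^*$ with $h(A_i)=p_i'a_ip_i''$ for $i\in\{1,\dots,k+1\}$ and $$\psi(p''_{j+1}p'_{j+2})-\psi(p''_jp'_{j+1})+D_jM=d_j\qquad\text{for } j\in\{1,\dots,k-1\}.$$ -}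

module Defs where

open import Algebra.Morphism.Structures using (IsMonoidHomomorphism)
open import Data.Fin.Base using (Fin; zero; suc; toℕ; inject₁; fromℕ<)
open import Data.Fin.Properties using (toℕ-fromℕ<; _≟_; _<?_)
open import Data.Integer.Base using (ℤ; +_; 0ℤ; 1ℤ; ∣_∣)
import Data.Integer.Base as ℤ
import Data.Integer.Properties as ℤ
open import Data.List.Base using (List; []; _∷_; [_]; _++_; length; lookup; map; filter; foldr; allFin; fromMaybe; cartesianProduct; ++-[]-rawMonoid)
open import Data.List.Extrema.Nat using (max)
open import Data.List.Properties using (length-++; ++-assoc; ++-identityʳ)
open import Data.Maybe.Base using (Maybe)
open import Data.Nat.Base using (ℕ; zero; suc; _+_; _∸_; _≤_; _<_; z≤n; s≤s)
import Data.Nat.Properties as ℕ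
open import Data.Product.Base using (Σ; ∃-syntax; _×_; _,_; proj₁; proj₂)
open import Data.Sum.Base using (inj₁; inj₂)
open import Data.Vec.Functional using (Vector; head; tail; replicate)
import Function.Endo.Propositional as Endo
open import Relation.Binary.PropositionalEquality using (_≡_; _≗_; refl; sym; trans; cong; subst)
open import Relation.Nullary.Decidable using (_×-dec_)

open import Algebra.Properties.Monoid.Sum ℤ.+-0-monoid using (sum)

-- The alphabet {σ₁,…,σₘ} is Fin m, with σ₁ = zero.

Word : ℕ → Set
Word m = List (Fin m)

InfiniteWord : ℕ → Set
InfiniteWord m = ℕ → Fin m

IsMorphism : ∀ {m} → (Word m → Word m) → Set
IsMorphism {m} = IsMonoidHomomorphism (++-[]-rawMonoid (Fin m)) (++-[]-rawMonoid (Fin m))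

OccursAt : ∀ {m} → ℕ → Word m → InfiniteWord m → Set
OccursAt p u w = ∀ (i : Fin (length u)) → lookup u i ≡ w (p + toℕ i)

_PrefixOf_ : ∀ {m} → Word m → InfiniteWord m → Set
u PrefixOf w = OccursAt 0 u w

_FactorOf_ : ∀ {m} → Word m → InfiniteWord m → Set
u FactorOf w = ∃[ p ] OccursAt p u w

iter : ∀ {m} → (Word m → Word m) → ℕ → Word m → Word m
iter {m} h n = h ^ n
  where open Endo (Word m) using (_^_)

-- w is h^ω(σ).  For the morphisms considered here such a w exists and is
-- unique; see hω-exists and hω-unique below.
Is-hω : ∀ {m} → (Word m → Word m) → Fin m → InfiniteWord m → Set
Is-hω h σ w = ∀ n → iter h n [ σ ] PrefixOf w

ψ : ∀ {m} → Word m → Vector ℕ m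
ψ u i = length (filter (i ≟_) u)

ψℤ : ∀ {m} → Word m → Vector ℤ m
ψℤ u i = + ψ u i

frequencyMatrix : ∀ {m} → (Word m → Word m) → Fin m → Vector ℤ m
frequencyMatrix h i = ψℤ (h [ i ])

infixl 6 _+ᵥ_ _-ᵥ_
infixl 7 _∙_ _*ᵥ_

_+ᵥ_ _-ᵥ_ : ∀ {m} → Vector ℤ m → Vector ℤ m → Vector ℤ m
(u +ᵥ v) i = u i ℤ.+ v i
(u -ᵥ v) i = u i ℤ.- v i

_∙_ : ∀ {m} → Vector ℤ m → Vector ℤ m → ℤ
u ∙ v = sum (λ i → u i ℤ.* v i)

_*ᵥ_ : ∀ {m n} → Vector ℤ m → (Fin m → Vector ℤ n) → Vector ℤ n
(v *ᵥ M) c = v ∙ (λ r → M r c)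

ones : ∀ {m} → Vector ℤ m
ones = replicate _ 1ℤ

-- Template m l is the type of (l+1)-templates [a₁,…,a_{l+2},d₁,…,d_l] over
-- Fin m; all indices are shifted down by one, and nothing stands for ε.
record Template (m l : ℕ) : Set where
  field
    a : Vector (Maybe (Fin m)) (suc (suc l))
    d : Vector (Vector ℤ m) l

open Template public

interleave : ∀ {m k} → Vector (Maybe (Fin m)) (suc k) → Vector (Word m) k → Word m
interleave {k = zero}  a X = fromMaybe (head a)
interleave {k = suc k} a X = fromMaybe (head a) ++ head X ++ interleave (tail a) (tail X)

_InstanceOf_ : ∀ {m l} → Word m → Template m l → Set
_InstanceOf_ {m} {l} w t =
  Σ (Vector (Word m) (suc l)) λ X →
    w ≡ interleave (a t) X ×
    (∀ i → ψℤ (X (suc i)) -ᵥ ψℤ (X (inject₁ i)) ≗ d t i)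

IsParent : ∀ {m l} → (Word m → Word m) → Template m l → Template m l → Set
IsParent {m} {l} h tₚ t =
  Σ (Vector (Word m) (suc (suc l))) λ p′ →
  Σ (Vector (Word m) (suc (suc l))) λ p″ →
    (∀ i → h (fromMaybe (a tₚ i)) ≡ p′ i ++ fromMaybe (a t i) ++ p″ i) ×
    (∀ (j : Fin l) →
       let j₀ = inject₁ (inject₁ j)
           j₁ = inject₁ (suc j)
           j₂ = suc (suc j)
       in ψℤ (p″ j₁ ++ p′ j₂) -ᵥ ψℤ (p″ j₀ ++ p′ j₁) +ᵥ d tₚ j *ᵥ frequencyMatrix h
            ≗ d t j)

-- The default 0 in the two maxima is immaterial: the entries are natural
-- numbers, and the lists are non-empty when m ≥ 1, respectively l ≥ 1.

maxImageLength : ∀ {m} → (Word m → Word m) → ℕ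
maxImageLength {m} h = max 0 (map (λ σ → length (h [ σ ])) (allFin m))

-- ∑_{r=i}^{j-1} d_r · (1,…,1)
segmentSum : ∀ {m l} → Template m l → Fin (suc l) → Fin (suc l) → ℤ
segmentSum {m} {l} t i j =
  foldr ℤ._+_ 0ℤ
    (map (λ r → d t r ∙ ones)
      (filter (λ r → (toℕ i ℕ.≤? toℕ r) ×-dec (toℕ r ℕ.<? toℕ j)) (allFin l)))

maxSegmentSum : ∀ {m l} → Template m l → ℕ
maxSegmentSum {m} {l} t =
  max 0
    (map (λ (i , j) → ∣ segmentSum t i j ∣)
      (filter (λ (i , j) → i <? j) (cartesianProduct (allFin (suc l)) (allFin (suc l)))))

module _ {m : ℕ} {h : Word m → Word m} {σ : Fin m} {x : Word m}
         (hom : IsMorphism h)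
         (hσ : h [ σ ] ≡ σ ∷ x)
         (growing : ∀ i → 1 < length (h [ i ])) where

  open IsMonoidHomomorphism hom using (homo)

  private
    H : ℕ → Word m
    H n = iter h n [ σ ]

    doubles : ∀ u → length u + length u ≤ length (h u)
    doubles [] = z≤n
    doubles (y ∷ u) = begin
      suc (length u + suc (length u))  ≡⟨ cong suc (ℕ.+-suc (length u) (length u)) ⟩
      2 + (length u + length u)        ≤⟨ ℕ.+-mono-≤ (growing y) (doubles u) ⟩
      length (h [ y ]) + length (h u)  ≡⟨ length-++ (h [ y ]) ⟨
      length (h [ y ] ++ h u)          ≡⟨ cong length (homo [ y ] u) ⟨
      length (h (y ∷ u))               ∎
      where open ℕ.≤-Reasoning

    long : ∀ n → n < length (H n)
    long zero    = s≤s z≤n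
    long (suc n) =
      ℕ.≤-trans (ℕ.+-mono-≤ (ℕ.≤-trans (s≤s z≤n) (long n)) (long n)) (doubles (H n))

    step : ∀ n → ∃[ z ] H (suc n) ≡ H n ++ z
    step zero    = x , hσ
    step (suc n) = let z , e = step n in h z , trans (cong h e) (homo (H n) z)

    extend : ∀ n k → ∃[ z ] H (k + n) ≡ H n ++ z
    extend n zero    = [] , sym (++-identityʳ (H n))
    extend n (suc k) =
      let z , e = extend n k ; y , f = step (k + n)
      in z ++ y , trans f (trans (cong (_++ y) e) (++-assoc (H n) z y))

    lookup-++ : ∀ (u v : Word m) (i : Fin (length u)) (j : Fin (length (u ++ v))) →
                toℕ i ≡ toℕ j → lookup u i ≡ lookup (u ++ v) j
    lookup-++ (y ∷ u) v zero    zero    e = refl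
    lookup-++ (y ∷ u) v (suc i) (suc j) e = lookup-++ u v i j (ℕ.suc-injective e)

    lookup-≡ : ∀ {n n′} → n ≤ n′ → (i : Fin (length (H n))) (j : Fin (length (H n′))) →
               toℕ i ≡ toℕ j → lookup (H n) i ≡ lookup (H n′) j
    lookup-≡ {n} {n′} n≤n′ = subst P (sym eq) (lookup-++ (H n) z)
      where
      P : Word m → Set
      P v = (i : Fin (length (H n))) (j : Fin (length v)) →
            toℕ i ≡ toℕ j → lookup (H n) i ≡ lookup v j
      z = proj₁ (extend n (n′ ∸ n))
      eq : H n′ ≡ H n ++ z
      eq = trans (cong H (sym (ℕ.m∸n+n≡m n≤n′))) (proj₂ (extend n (n′ ∸ n)))

  hω-exists : ∃[ w ] Is-hω h σ w
  hω-exists = w , isLimit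
    where
    w : InfiniteWord m
    w i = lookup (H i) (fromℕ< (long i))
    isLimit : Is-hω h σ w
    isLimit n i with ℕ.≤-total n (toℕ i)
    ... | inj₁ n≤i = lookup-≡ n≤i i _ (sym (toℕ-fromℕ< (long (toℕ i))))
    ... | inj₂ i≤n = sym (lookup-≡ i≤n _ i (toℕ-fromℕ< (long (toℕ i))))

  hω-unique : ∀ {v w} → Is-hω h σ v → Is-hω h σ w → v ≗ w
  hω-unique {v} {w} pv pw n =
    subst (λ k → v k ≡ w k) (toℕ-fromℕ< (long n))
      (trans (sym (pv n (fromℕ< (long n)))) (pw n (fromℕ< (long n))))

{-# OPTIONS --safe #-}
-- The word I sits inside h(W) for some prefix W of hω.  Cutting W along the
-- letters aᵢ of the template yields the parent and the word J, provided each
-- Xᵢ is at least as long as the part of h(Aᵢ) to the right of aᵢ, which has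
-- length at most N − 1.  If some Xᵢ had length at most N − 2, then all the
-- others would have length at most N − 2 + maxSegmentSum t, and I would be too
-- short.  Finally h(J) exceeds I by at most 2(N − 1) letters, while
-- 2|J| ≤ |h(J)| and |I| > 2(N − 1), hence |J| < |I|.
module Submission where

open import Defs
open import Algebra.Morphism.Structures using (IsMonoidHomomorphism)
open import Data.Fin.Base using (Fin; zero; suc; toℕ; inject₁; fromℕ; punchIn)
open import Data.Fin.Properties using (_≟_; _<?_; <-cmp; punchInᵢ≢i)
open import Data.Integer.Base using (ℤ; +_; 0ℤ; 1ℤ; ∣_∣)
import Data.Integer.Base as ℤ
import Data.Integer.Properties as ℤ
import Data.Integer.Tactic.RingSolver as ℤ-Solver
open import Data.List.Base using (List; []; _∷_; [_]; _++_; length; lookup; map; filter; foldr; tabulate; fromMaybe; take; drop)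
open import Data.List.Extrema.Nat using (xs≤max)
open import Data.List.Membership.Propositional.Properties using (∈-map⁺; ∈-filter⁺; ∈-cartesianProduct⁺; ∈-allFin)
open import Data.List.Properties using (take++drop≡id; length-take; length-drop; length-++; length-++-≤ʳ; ++-assoc; ++-cancelˡ; ++-cancelʳ; filter-++; filter-accept; filter-reject; filter-none; ∷-injective)
import Data.List.Relation.Unary.All as All
import Data.List.Relation.Unary.All.Properties as All
open import Data.Maybe.Base using (Maybe; just; nothing)
open import Data.Nat.Base using (ℕ; zero; suc; _+_; _*_; _∸_; _≤_; _<_; _>_; z≤n; s≤s; s≤s⁻¹)
import Data.Nat.Properties as ℕ
import Data.Nat.Tactic.RingSolver as ℕ-Solver
open import Data.Product.Base using (∃-syntax; _×_; _,_; proj₁; proj₂)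
open import Data.Sum.Base using (_⊎_; inj₁; inj₂)
open import Data.Vec.Functional as Vector using (Vector; head; tail; removeAt)
open import Function.Base using (_∘_)
open import Relation.Binary.Definitions using (tri<; tri≈; tri>)
open import Relation.Binary.PropositionalEquality using (_≡_; _≢_; refl; sym; trans; cong; cong₂; subst; module ≡-Reasoning)
open import Relation.Nullary using (yes; no; contradiction)
open import Relation.Nullary.Decidable using (_×-dec_)
open import Relation.Unary using (Decidable)

open import Algebra.Properties.CommutativeMonoid.Sum ℤ.+-0-commutativeMonoid using (sum; sum-cong-≗; sum-remove; ∑-distrib-+; sum-replicate-zero)

-- Parikh vectors

ψℤ-++ : ∀ {m} (u v : Word m) i → ψℤ (u ++ v) i ≡ ψℤ u i ℤ.+ ψℤ v i
ψℤ-++ u v i = cong +_ (trans (cong length (filter-++ (i ≟_) u v)) (length-++ (filter (i ≟_) u)))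

∙-distribʳ-+ : ∀ {m} (w u v : Vector ℤ m) → (u +ᵥ v) ∙ w ≡ u ∙ w ℤ.+ v ∙ w
∙-distribʳ-+ w u v =
  trans (sum-cong-≗ (λ i → ℤ.*-distribʳ-+ (w i) (u i) (v i)))
        (∑-distrib-+ (λ i → u i ℤ.* w i) (λ i → v i ℤ.* w i))

-- Reduces to additivity, applied to u = (u - v) + v.
∙-distribʳ-- : ∀ {m} (w u v : Vector ℤ m) → (u -ᵥ v) ∙ w ≡ u ∙ w ℤ.- v ∙ w
∙-distribʳ-- w u v = begin
  (u -ᵥ v) ∙ w                        ≡⟨ lem ((u -ᵥ v) ∙ w) (v ∙ w) ⟩
  (u -ᵥ v) ∙ w ℤ.+ v ∙ w ℤ.- v ∙ w    ≡⟨ cong (ℤ._- v ∙ w) (∙-distribʳ-+ w (u -ᵥ v) v) ⟨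
  (u -ᵥ v +ᵥ v) ∙ w ℤ.- v ∙ w         ≡⟨ cong (ℤ._- v ∙ w) (sum-cong-≗ (λ i → cong (ℤ._* w i) (lem′ (u i) (v i)))) ⟩
  u ∙ w ℤ.- v ∙ w                     ∎
  where
  open ≡-Reasoning
  lem : ∀ a b → a ≡ a ℤ.+ b ℤ.- b
  lem = ℤ-Solver.solve-∀
  lem′ : ∀ a b → a ℤ.- b ℤ.+ b ≡ a
  lem′ = ℤ-Solver.solve-∀

ψℤ[y]∙ : ∀ {m} (y : Fin m) (v : Vector ℤ m) → ψℤ [ y ] ∙ v ≡ v y
ψℤ[y]∙ {suc m} y v = begin
  ψℤ [ y ] ∙ v                                            ≡⟨ sum-remove {i = y} f ⟩
  f y ℤ.+ sum (removeAt f y)                              ≡⟨ cong₂ ℤ._+_ at-y (trans (sum-cong-≗ off-y) (sum-replicate-zero m)) ⟩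
  v y ℤ.+ 0ℤ                                              ≡⟨ ℤ.+-identityʳ (v y) ⟩
  v y                                                     ∎
  where
  open ≡-Reasoning
  f : Vector ℤ (suc m)
  f i = ψℤ [ y ] i ℤ.* v i
  at-y : f y ≡ v y
  at-y = trans (cong (λ u → + length u ℤ.* v y) (filter-accept (y ≟_) {xs = []} refl)) (ℤ.*-identityˡ (v y))
  off-y : ∀ i → removeAt f y i ≡ 0ℤ
  off-y i = cong (λ u → + length u ℤ.* v (punchIn y i)) (filter-reject (punchIn y i ≟_) {xs = []} (punchInᵢ≢i y i))

-- An additive function on words is determined by its values on letters, and the Parikh vector
-- counts how often each value enters. Taking for `F` the length, or one coordinate of ψ(h(u)),
-- gives the next two identities.
ψℤ-linear : ∀ {m} (F : Word m → ℤ) → F [] ≡ 0ℤ → (∀ u v → F (u ++ v) ≡ F u ℤ.+ F v) →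
            ∀ u → ψℤ u ∙ (λ r → F [ r ]) ≡ F u
ψℤ-linear {m} F F-[] F-++ []      = trans (sum-replicate-zero m) (sym F-[])
ψℤ-linear {m} F F-[] F-++ (y ∷ u) = begin
  ψℤ (y ∷ u) ∙ G                ≡⟨ sum-cong-≗ (λ i → cong (ℤ._* G i) (ψℤ-++ [ y ] u i)) ⟩
  (ψℤ [ y ] +ᵥ ψℤ u) ∙ G        ≡⟨ ∙-distribʳ-+ G (ψℤ [ y ]) (ψℤ u) ⟩
  ψℤ [ y ] ∙ G ℤ.+ ψℤ u ∙ G     ≡⟨ cong₂ ℤ._+_ (ψℤ[y]∙ y G) (ψℤ-linear F F-[] F-++ u) ⟩
  F [ y ] ℤ.+ F u               ≡⟨ F-++ [ y ] u ⟨
  F (y ∷ u)                     ∎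
  where
  open ≡-Reasoning
  G : Vector ℤ m
  G r = F [ r ]

ψℤ∙ones : ∀ {m} (u : Word m) → ψℤ u ∙ ones ≡ + length u
ψℤ∙ones = ψℤ-linear (λ u → + length u) refl (λ u v → cong +_ (length-++ u))

ψℤ*frequencyMatrix : ∀ {m} {h : Word m → Word m} → IsMorphism h →
                     ∀ u c → (ψℤ u *ᵥ frequencyMatrix h) c ≡ ψℤ (h u) c
ψℤ*frequencyMatrix {h = h} hom u c =
  ψℤ-linear (λ u → ψℤ (h u) c) (cong (λ v → ψℤ v c) ε-homo)
    (λ u v → trans (cong (λ z → ψℤ z c) (homo u v)) (ψℤ-++ (h u) (h v) c)) u
  where open IsMonoidHomomorphism hom

-- Differences of lengths

-- `P?` and `e` are arbitrary because the induction passes to `e ∘ suc` while the filter keeps its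
-- predicate on the original index set. The two implications between `P (e r)` and the inequalities
-- say that the filter selects exactly the r with i ≤ r < j.
foldr-telescope :
  ∀ {A : Set} {P : A → Set} (P? : Decidable P) (f : A → ℤ) {l} (e : Fin l → A) (g : Fin (suc l) → ℤ) i j →
  (∀ r → f (e r) ≡ g (suc r) ℤ.- g (inject₁ r)) →
  (∀ r → P (e r) → toℕ i ≤ toℕ r × toℕ r < toℕ j) →
  (∀ r → toℕ i ≤ toℕ r → toℕ r < toℕ j → P (e r)) →
  toℕ i ≤ toℕ j →
  foldr ℤ._+_ 0ℤ (map f (filter P? (tabulate e))) ≡ g j ℤ.- g i
foldr-telescope P? f e g zero zero fe to from i≤j =
  trans (cong (foldr ℤ._+_ 0ℤ ∘ map f) (filter-none P? (All.tabulate⁺ (λ r Per → contradiction (proj₂ (to r Per)) λ ()))))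
        (sym (ℤ.+-inverseʳ (g zero)))
-- The first index is selected; the remaining ones telescope from zero again, now along `g ∘ suc`.
foldr-telescope P? f {suc l} e g zero (suc j) fe to from i≤j = begin
  foldr ℤ._+_ 0ℤ (map f (filter P? (tabulate e)))
    ≡⟨ cong (foldr ℤ._+_ 0ℤ ∘ map f) (filter-accept P? (from zero z≤n (s≤s z≤n))) ⟩
  f (e zero) ℤ.+ foldr ℤ._+_ 0ℤ (map f (filter P? (tabulate (e ∘ suc))))
    ≡⟨ cong₂ ℤ._+_ (fe zero)
         (foldr-telescope P? f (e ∘ suc) (g ∘ suc) zero j (fe ∘ suc)
           (λ r Per → z≤n , s≤s⁻¹ (proj₂ (to (suc r) Per)))
           (λ r _ r<j → from (suc r) z≤n (s≤s r<j)) z≤n) ⟩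
  (g (suc zero) ℤ.- g zero) ℤ.+ (g (suc j) ℤ.- g (suc zero))
    ≡⟨ lem (g (suc zero)) (g zero) (g (suc j)) ⟩
  g (suc j) ℤ.- g zero ∎
  where
  open ≡-Reasoning
  lem : ∀ a b c → (a ℤ.- b) ℤ.+ (c ℤ.- a) ≡ c ℤ.- b
  lem = ℤ-Solver.solve-∀
-- The first index lies before the segment and is filtered out, so both endpoints drop by one.
foldr-telescope P? f {suc l} e g (suc i) (suc j) fe to from i≤j =
  trans (cong (foldr ℤ._+_ 0ℤ ∘ map f) (filter-reject P? (λ Pe → contradiction (proj₁ (to zero Pe)) λ ())))
        (foldr-telescope P? f (e ∘ suc) (g ∘ suc) i j (fe ∘ suc)
          (λ r Per → let i≤r , r<j = to (suc r) Per in s≤s⁻¹ i≤r , s≤s⁻¹ r<j)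
          (λ r i≤r r<j → from (suc r) (s≤s i≤r) (s≤s r<j)) (s≤s⁻¹ i≤j))

module _ {m l} (t : Template m l) (X : Vector (Word m) (suc l))
         (ψ-diff : ∀ i c → (ψℤ (X (suc i)) -ᵥ ψℤ (X (inject₁ i))) c ≡ d t i c) where

  -- Pairing a Parikh vector with (1,...,1) gives the length, so each d_r · (1,...,1) is the
  -- difference of two consecutive lengths, and the sum telescopes.
  segmentSum-length : ∀ i j → toℕ i ≤ toℕ j → segmentSum t i j ≡ + length (X j) ℤ.- + length (X i)
  segmentSum-length i j =
    foldr-telescope (λ r → (toℕ i ℕ.≤? toℕ r) ×-dec (toℕ r ℕ.<? toℕ j)) (λ r → d t r ∙ ones)
      (λ r → r) (λ r → + length (X r)) i j step (λ r p → p) (λ r → _,_)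
    where
    step : ∀ r → d t r ∙ ones ≡ + length (X (suc r)) ℤ.- + length (X (inject₁ r))
    step r = begin
      d t r ∙ ones                                          ≡⟨ sum-cong-≗ (λ c → cong (ℤ._* 1ℤ) (ψ-diff r c)) ⟨
      (ψℤ (X (suc r)) -ᵥ ψℤ (X (inject₁ r))) ∙ ones         ≡⟨ ∙-distribʳ-- ones (ψℤ (X (suc r))) (ψℤ (X (inject₁ r))) ⟩
      ψℤ (X (suc r)) ∙ ones ℤ.- ψℤ (X (inject₁ r)) ∙ ones   ≡⟨ cong₂ ℤ._-_ (ψℤ∙ones (X (suc r))) (ψℤ∙ones (X (inject₁ r))) ⟩
      + length (X (suc r)) ℤ.- + length (X (inject₁ r))     ∎
      where open ≡-Reasoning

  segmentSum≤max : ∀ i j → toℕ i < toℕ j → ∣ segmentSum t i j ∣ ≤ maxSegmentSum t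
  segmentSum≤max i j i<j =
    All.lookup (xs≤max 0 _)
      (∈-map⁺ (λ (i , j) → ∣ segmentSum t i j ∣)
        (∈-filter⁺ (λ (i , j) → i <? j) (∈-cartesianProduct⁺ (∈-allFin i) (∈-allFin j)) i<j))

  -- The maximum ranges over i < j only, but it is taken over absolute values and so controls the
  -- difference of lengths in both directions.
  length-diff : ∀ i j → length (X j) ≤ length (X i) + maxSegmentSum t
  length-diff i j with <-cmp i j
  ... | tri≈ _ refl _ = ℕ.m≤m+n (length (X i)) (maxSegmentSum t)
  ... | tri< i<j _ _ = begin
    length (X j)                                                          ≡⟨ cong ∣_∣ (lem (+ length (X j)) (+ length (X i))) ⟩
    ∣ + length (X i) ℤ.+ (+ length (X j) ℤ.- + length (X i)) ∣            ≤⟨ ℤ.∣i+j∣≤∣i∣+∣j∣ (+ length (X i)) (+ length (X j) ℤ.- + length (X i)) ⟩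
    length (X i) + ∣ + length (X j) ℤ.- + length (X i) ∣                  ≡⟨ cong (λ z → length (X i) + ∣ z ∣) (segmentSum-length i j (ℕ.<⇒≤ i<j)) ⟨
    length (X i) + ∣ segmentSum t i j ∣                                   ≤⟨ ℕ.+-monoʳ-≤ (length (X i)) (segmentSum≤max i j i<j) ⟩
    length (X i) + maxSegmentSum t                                        ∎
    where
    open ℕ.≤-Reasoning
    lem : ∀ a b → a ≡ b ℤ.+ (a ℤ.- b)
    lem = ℤ-Solver.solve-∀
  ... | tri> _ _ j<i = begin
    length (X j)                                                          ≡⟨ cong ∣_∣ (lem (+ length (X j)) (+ length (X i))) ⟩
    ∣ + length (X i) ℤ.- (+ length (X i) ℤ.- + length (X j)) ∣            ≤⟨ ℤ.∣i-j∣≤∣i∣+∣j∣ (+ length (X i)) (+ length (X i) ℤ.- + length (X j)) ⟩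
    length (X i) + ∣ + length (X i) ℤ.- + length (X j) ∣                  ≡⟨ cong (λ z → length (X i) + ∣ z ∣) (segmentSum-length j i (ℕ.<⇒≤ j<i)) ⟨
    length (X i) + ∣ segmentSum t j i ∣                                   ≤⟨ ℕ.+-monoʳ-≤ (length (X i)) (segmentSum≤max j i j<i) ⟩
    length (X i) + maxSegmentSum t                                        ∎
    where
    open ℕ.≤-Reasoning
    lem : ∀ a b → a ≡ b ℤ.- (b ℤ.- a)
    lem = ℤ-Solver.solve-∀

-- Occurrences in infinite words

module _ {m} {w : InfiniteWord m} where

  occursAt-∷⁻ : ∀ {q y u} → OccursAt q (y ∷ u) w → OccursAt (suc q) u w
  occursAt-∷⁻ {q} o i = trans (o (suc i)) (cong w (ℕ.+-suc q (toℕ i)))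

  occursAt-∷⁺ : ∀ {q y u} → y ≡ w q → OccursAt (suc q) u w → OccursAt q (y ∷ u) w
  occursAt-∷⁺ {q} e o zero    = trans e (cong w (sym (ℕ.+-identityʳ q)))
  occursAt-∷⁺ {q} e o (suc i) = trans (o i) (cong w (sym (ℕ.+-suc q (toℕ i))))

  occursAt-head : ∀ {q y u} → OccursAt q (y ∷ u) w → y ≡ w q
  occursAt-head {q} o = trans (o zero) (cong w (ℕ.+-identityʳ q))

  occursAt-++ˡ : ∀ {q} u {v} → OccursAt q (u ++ v) w → OccursAt q u w
  occursAt-++ˡ []      o ()
  occursAt-++ˡ (y ∷ u) o = occursAt-∷⁺ (occursAt-head o) (occursAt-++ˡ u (occursAt-∷⁻ o))

  occursAt-++ʳ : ∀ {q} u {v} → OccursAt q (u ++ v) w → OccursAt (q + length u) v w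
  occursAt-++ʳ {q} []      {v} o = subst (λ k → OccursAt k v w) (sym (ℕ.+-identityʳ q)) o
  occursAt-++ʳ {q} (y ∷ u) {v} o =
    subst (λ k → OccursAt k v w) (sym (ℕ.+-suc q (length u))) (occursAt-++ʳ u (occursAt-∷⁻ o))

  occursAt-prefix : ∀ {q} u v → OccursAt q u w → OccursAt q v w → length u ≤ length v → ∃[ r ] v ≡ u ++ r
  occursAt-prefix []      v       ou ov u≤v = v , refl
  occursAt-prefix (y ∷ u) (z ∷ v) ou ov (s≤s u≤v) =
    let r , e = occursAt-prefix u v (occursAt-∷⁻ ou) (occursAt-∷⁻ ov) u≤v
    in r , cong₂ _∷_ (trans (occursAt-head ov) (sym (occursAt-head ou))) e

  -- Dropping p letters from `v` leaves a word that occurs at position p, as `u` does, and is at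
  -- least as long; hence it begins with `u`.
  factor-of-long-prefix : ∀ {p u v} → OccursAt p u w → v PrefixOf w → p + length u ≤ length v →
                          ∃[ L ] ∃[ R ] v ≡ L ++ u ++ R
  factor-of-long-prefix {p} {u} {v} ou ov p+u≤v =
    let R , e = occursAt-prefix u (drop p v) ou ov′ u≤
    in take p v , R , trans (sym (take++drop≡id p v)) (cong (take p v ++_) e)
    where
    take-length : length (take p v) ≡ p
    take-length = trans (length-take p v) (ℕ.m≤n⇒m⊓n≡m (ℕ.≤-trans (ℕ.m≤m+n p (length u)) p+u≤v))
    ov′ : OccursAt p (drop p v) w
    ov′ = subst (λ k → OccursAt k (drop p v) w) take-length
            (occursAt-++ʳ (take p v) (subst (_PrefixOf w) (sym (take++drop≡id p v)) ov))
    u≤ : length u ≤ length (drop p v)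
    u≤ = subst (length u ≤_) (sym (length-drop p v))
           (subst (_≤ length v ∸ p) (ℕ.m+n∸m≡n p (length u)) (ℕ.∸-monoˡ-≤ p p+u≤v))

-- Parsing factors of h(W)

-- Levi's lemma. In the second case the overhang contains a letter `c`; this letter later gives the
-- bound N - 1 instead of N for proper prefixes and suffixes of images.
++-compare : ∀ {A : Set} (u {v} z {w} : List A) → u ++ v ≡ z ++ w →
             (∃[ z′ ] (z ≡ u ++ z′ × v ≡ z′ ++ w)) ⊎
             (∃[ c ] ∃[ u′ ] (u ≡ z ++ c ∷ u′ × w ≡ c ∷ u′ ++ v))
++-compare []      z       e = inj₁ (z , refl , e)
++-compare (x ∷ u) []      e = inj₂ (x , u , refl , sym e)
++-compare (x ∷ u) (y ∷ z) e with refl , e′ ← ∷-injective e with ++-compare u z e′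
... | inj₁ (z′ , refl , f)     = inj₁ (z′ , refl , f)
... | inj₂ (c , u′ , refl , f) = inj₂ (c , u′ , refl , f)

module _ {m} {h : Word m → Word m} (hom : IsMorphism h)
         {B : ℕ} (h-bound : ∀ y → length (h [ y ]) ≤ suc B) where

  open IsMonoidHomomorphism hom using (homo; ε-homo)

  private
    proper-suffix-bound : ∀ u {c v y} → h [ y ] ≡ u ++ c ∷ v → length v ≤ B
    proper-suffix-bound u {c} {v} {y} e =
      s≤s⁻¹ (ℕ.≤-trans (subst (λ z → suc (length v) ≤ length z) (sym e) (length-++-≤ʳ (c ∷ v) {u})) (h-bound y))

    proper-prefix-bound : ∀ u {c v y} → h [ y ] ≡ u ++ c ∷ v → length u ≤ B
    proper-prefix-bound u {c} {v} {y} e = s≤s⁻¹ (begin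
      suc (length u)                 ≤⟨ s≤s (ℕ.m≤m+n (length u) (length v)) ⟩
      suc (length u + length v)      ≡⟨ ℕ.+-suc (length u) (length v) ⟨
      length u + length (c ∷ v)      ≡⟨ length-++ u ⟨
      length (u ++ c ∷ v)            ≡⟨ cong length e ⟨
      length (h [ y ])               ≤⟨ h-bound y ⟩
      suc B                          ∎)
      where open ℕ.≤-Reasoning

  -- `Z` and `T` are the contexts to the left and right of `a` in `h W`. The fields `A`, `p′`, `p″`
  -- are what the parent relation asks for at one index, and `T-split` lets the next cut take place
  -- inside `W₂`. Since `suc B` bounds the images, `B` stands for N - 1.
  record Cut (W Z : Word m) (a : Maybe (Fin m)) (T : Word m) : Set where
    constructor mkCut
    field
      Y W₂     : Word m
      A        : Maybe (Fin m)
      p′ p″    : Word m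
      W-split  : W ≡ Y ++ fromMaybe A ++ W₂
      Z-split  : Z ≡ h Y ++ p′
      A-image  : h (fromMaybe A) ≡ p′ ++ fromMaybe a ++ p″
      T-split  : T ≡ p″ ++ h W₂
      p′-bound : length p′ ≤ B
      p″-bound : length p″ ≤ B

  -- A position with a = ε strictly inside h(y) gets A = y; at the border of two
  -- images it gets A = ε.  This keeps p′ and p″ below the length bound.
  cut : ∀ W Z a T → h W ≡ Z ++ fromMaybe a ++ T → Cut W Z a T
  cut [] Z a T e with Z | a | T | trans (sym ε-homo) e
  ... | [] | nothing | [] | _ = mkCut [] [] nothing [] [] refl (sym (cong (_++ []) ε-homo)) ε-homo (sym ε-homo) z≤n z≤n
  cut (y ∷ W) Z a T e with ++-compare (h [ y ]) Z (trans (sym (homo [ y ] W)) e)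
  ... | inj₁ (Z′ , refl , e′) = record
    { Cut c
    ; Y       = y ∷ Y
    ; W-split = cong (y ∷_) W-split
    ; Z-split = trans (cong (h [ y ] ++_) Z-split)
                  (trans (sym (++-assoc (h [ y ]) (h Y) p′)) (cong (_++ p′) (sym (homo [ y ] Y))))
    }
    where
    c : Cut W Z′ a T
    c = cut W Z′ a T e′
    open Cut c
  cut (y ∷ W) Z (just b) T e | inj₂ (c , V , e₁ , e₂) with refl , e₃ ← ∷-injective e₂ =
    mkCut [] W (just y) Z V refl (sym (cong (_++ Z) ε-homo)) e₁ e₃ (proper-prefix-bound Z e₁) (proper-suffix-bound Z e₁)
  cut (y ∷ W) [] nothing T e | inj₂ _ =
    mkCut [] (y ∷ W) nothing [] [] refl (sym (cong (_++ []) ε-homo)) ε-homo (sym e) z≤n z≤n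
  cut (y ∷ W) (z ∷ Z) nothing T e | inj₂ (c , V , e₁ , e₂) =
    mkCut [] W (just y) (z ∷ Z) (c ∷ V) refl (sym (cong (_++ z ∷ Z) ε-homo)) e₁ e₂
      (proper-prefix-bound (z ∷ Z) e₁)
      -- Here `p″` is all of `c ∷ V`; the non-empty left part, starting with `z`, makes it a proper
      -- suffix of `h [ y ]`.
      (ℕ.≤-trans (length-++-≤ʳ (c ∷ V) {Z}) (proper-suffix-bound [] e₁))

  -- Only the two outermost overhangs carry a length bound: they are what `h J` has in excess of
  -- `I`, whereas the inner ones lie inside the words `X i`.
  record Parse {k} (a : Vector (Maybe (Fin m)) (suc k)) (X : Vector (Word m) k) (W L R : Word m) : Set where
    field
      A            : Vector (Maybe (Fin m)) (suc k)
      Y            : Vector (Word m) k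
      p′ p″        : Vector (Word m) (suc k)
      Q S          : Word m
      W-split      : W ≡ Q ++ interleave A Y ++ S
      L-split      : L ≡ h Q ++ p′ zero
      R-split      : R ≡ p″ (fromℕ k) ++ h S
      A-image      : ∀ i → h (fromMaybe (A i)) ≡ p′ i ++ fromMaybe (a i) ++ p″ i
      X-split      : ∀ i → X i ≡ p″ (inject₁ i) ++ h (Y i) ++ p′ (suc i)
      first-bound  : length (p′ zero) ≤ B
      last-bound   : length (p″ (fromℕ k)) ≤ B

  -- Cut at the first template letter, then parse the rest inside `W₂`. As `X zero` has length at
  -- least `B`, it contains the overhang `p″` of that cut, and what is left of it is the left
  -- context of the next cut.
  parse : ∀ {k} (a : Vector (Maybe (Fin m)) (suc k)) X W L R → (∀ i → B ≤ length (X i)) →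
          h W ≡ L ++ interleave a X ++ R → Parse a X W L R
  parse {zero} a X W L R long e = record
    { A = λ _ → A ; Y = λ () ; p′ = λ _ → p′ ; p″ = λ _ → p″ ; Q = Y ; S = W₂
    ; W-split = W-split ; L-split = Z-split ; R-split = T-split
    ; A-image = λ { zero → A-image } ; X-split = λ ()
    ; first-bound = p′-bound ; last-bound = p″-bound }
    where open Cut (cut W L (a zero) R e)
  parse {suc k} a X W L R long e with cut W L (a zero) (X zero ++ interleave (tail a) (tail X) ++ R) e′
    where
    a₀ rest : Word m
    a₀   = fromMaybe (a zero)
    rest = interleave (tail a) (tail X)
    e′ : h W ≡ L ++ a₀ ++ X zero ++ rest ++ R
    e′ = trans e (cong (L ++_) (trans (++-assoc a₀ (X zero ++ rest) R) (cong (a₀ ++_) (++-assoc (X zero) rest R))))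
  ... | c with ++-compare (Cut.p″ c) (X zero) (sym (Cut.T-split c))
  -- If `p″` ran past the end of `X zero`, then `X zero` would be strictly shorter than `B`.
  ... | inj₂ (b , V , e₁ , _) = contradiction (long zero) (ℕ.<⇒≱ (begin-strict
    length (X zero)                     <⟨ ℕ.m<m+n (length (X zero)) (s≤s z≤n) ⟩
    length (X zero) + length (b ∷ V)    ≡⟨ length-++ (X zero) ⟨
    length (X zero ++ b ∷ V)            ≡⟨ cong length e₁ ⟨
    length (Cut.p″ c)                   ≤⟨ Cut.p″-bound c ⟩
    B                                   ∎))
    where open ℕ.≤-Reasoning
  ... | inj₁ (Z , X₀-split , e₁) = record
    -- The part `P.Q` of `C.W₂` before the second cut becomes the first inner word, while the part
    -- `C.Y` before the first cut is the new `Q`.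
    { A = C.A Vector.∷ P.A ; Y = P.Q Vector.∷ P.Y ; p′ = C.p′ Vector.∷ P.p′ ; p″ = C.p″ Vector.∷ P.p″
    ; Q = C.Y ; S = P.S
    ; W-split = trans C.W-split (cong (C.Y ++_)
        (trans (cong (fromMaybe C.A ++_) (trans P.W-split (sym (++-assoc P.Q (interleave P.A P.Y) P.S))))
               (sym (++-assoc (fromMaybe C.A) (P.Q ++ interleave P.A P.Y) P.S))))
    ; L-split = C.Z-split
    ; R-split = P.R-split
    ; A-image = λ { zero → C.A-image ; (suc i) → P.A-image i }
    ; X-split = λ { zero → trans X₀-split (cong (C.p″ ++_) P.L-split) ; (suc i) → X-split′ i }
    ; first-bound = C.p′-bound
    ; last-bound  = P.last-bound
    }
    where
    module C = Cut c
    module P = Parse (parse (tail a) (tail X) C.W₂ Z R (long ∘ suc) e₁)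
    X-split′ : ∀ i → X (suc i) ≡ (C.p″ Vector.∷ P.p″) (inject₁ (suc i)) ++ h (P.Y i) ++ P.p′ (suc i)
    X-split′ = P.X-split

-- Lengths

length-fromMaybe : ∀ {A : Set} (x : Maybe A) → length (fromMaybe x) ≤ 1
length-fromMaybe (just _) = s≤s z≤n
length-fromMaybe nothing  = z≤n

length-interleave-∷ : ∀ {m k} (a : Vector (Maybe (Fin m)) (suc (suc k))) X {b c} →
                      length (head X) ≤ b → length (interleave (tail a) (tail X)) ≤ c →
                      length (interleave a X) ≤ suc (b + c)
length-interleave-∷ a X {b} {c} X₀≤b ≤c = begin
  length (interleave a X)
    ≡⟨ trans (length-++ (fromMaybe (head a))) (cong (λ n → length (fromMaybe (head a)) + n) (length-++ (head X))) ⟩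
  length (fromMaybe (head a)) + (length (head X) + length (interleave (tail a) (tail X)))
    ≤⟨ ℕ.+-mono-≤ (length-fromMaybe (head a)) (ℕ.+-mono-≤ X₀≤b ≤c) ⟩
  suc (b + c) ∎
  where open ℕ.≤-Reasoning

length-interleave-≤ : ∀ {m k} (a : Vector (Maybe (Fin m)) (suc k)) X {e} →
                      (∀ i → length (X i) ≤ e) → length (interleave a X) ≤ suc k + k * e
length-interleave-≤ {k = zero}  a X ≤e = length-fromMaybe (head a)
length-interleave-≤ {k = suc k} a X {e} ≤e = begin
  length (interleave a X)       ≤⟨ length-interleave-∷ a X (≤e zero) (length-interleave-≤ (tail a) (tail X) (≤e ∘ suc)) ⟩
  suc (e + (suc k + k * e))     ≡⟨ lem e k ⟩
  suc (suc k) + suc k * e       ∎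
  where
  open ℕ.≤-Reasoning
  lem : ∀ e k → suc (e + (suc k + k * e)) ≡ suc (suc k) + suc k * e
  lem = ℕ-Solver.solve-∀

-- The pieces before the `i`-th are peeled off, each costing at most `e` plus one letter; from there
-- on the better bound `c` replaces one `e`.
length-interleave-short : ∀ {m l} (a : Vector (Maybe (Fin m)) (suc (suc l))) X {c e} i →
                          length (X i) ≤ c → (∀ j → length (X j) ≤ e) →
                          length (interleave a X) ≤ suc (suc l) + (c + l * e)
length-interleave-short {l = l} a X {c} {e} zero Xᵢ≤c ≤e = begin
  length (interleave a X)       ≤⟨ length-interleave-∷ a X Xᵢ≤c (length-interleave-≤ (tail a) (tail X) (≤e ∘ suc)) ⟩
  suc (c + (suc l + l * e))     ≡⟨ lem c e l ⟩
  suc (suc l) + (c + l * e)     ∎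
  where
  open ℕ.≤-Reasoning
  lem : ∀ c e l → suc (c + (suc l + l * e)) ≡ suc (suc l) + (c + l * e)
  lem = ℕ-Solver.solve-∀
length-interleave-short {l = suc l} a X {c} {e} (suc i) Xᵢ≤c ≤e = begin
  length (interleave a X)                   ≤⟨ length-interleave-∷ a X (≤e zero) (length-interleave-short (tail a) (tail X) i Xᵢ≤c (≤e ∘ suc)) ⟩
  suc (e + (suc (suc l) + (c + l * e)))     ≡⟨ lem c e l ⟩
  suc (suc (suc l)) + (c + suc l * e)       ∎
  where
  open ℕ.≤-Reasoning
  lem : ∀ c e l → suc (e + (suc (suc l) + (c + l * e))) ≡ suc (suc (suc l)) + (c + suc l * e)
  lem = ℕ-Solver.solve-∀

length-image≤max : ∀ {m} (h : Word m → Word m) y → length (h [ y ]) ≤ maxImageLength h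
length-image≤max h y = All.lookup (xs≤max 0 _) (∈-map⁺ (λ σ → length (h [ σ ])) (∈-allFin y))

-- Growth under h and the length hypothesis

module _ {m} {h : Word m → Word m} (hom : IsMorphism h) (growing : ∀ i → 1 < length (h [ i ])) where

  open IsMonoidHomomorphism hom using (homo)

  length-doubles : ∀ u → length u + length u ≤ length (h u)
  length-doubles []      = z≤n
  length-doubles (y ∷ u) = begin
    suc (length u + suc (length u))     ≡⟨ cong suc (ℕ.+-suc (length u) (length u)) ⟩
    2 + (length u + length u)           ≤⟨ ℕ.+-mono-≤ (growing y) (length-doubles u) ⟩
    length (h [ y ]) + length (h u)     ≡⟨ length-++ (h [ y ]) ⟨
    length (h [ y ] ++ h u)             ≡⟨ cong length (homo [ y ] u) ⟨
    length (h (y ∷ u))                  ∎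
    where open ℕ.≤-Reasoning

  length-iter : ∀ σ n → n < length (iter h n [ σ ])
  length-iter σ zero    = s≤s z≤n
  length-iter σ (suc n) =
    ℕ.≤-trans (ℕ.+-mono-≤ (ℕ.≤-trans (s≤s z≤n) (length-iter σ n)) (length-iter σ n))
              (length-doubles (iter h n [ σ ]))

-- With `n` = N - 2, a piece of length at most `n` forces the other `l` pieces to length at most
-- `n + D`. Together with at most `l` + 2 template letters this gives exactly the threshold that `I`
-- exceeds.
all-pieces-long : ∀ {m l n} (t : Template m l) {I} ((X , _) : I InstanceOf t) →
                  suc (suc n) + l + l * (n + maxSegmentSum t) < length I →
                  ∀ i → suc n ≤ length (X i)
all-pieces-long {l = l} {n} t {I} (X , I≡ , ψ-diff) I-long i with suc n ℕ.≤? length (X i)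
... | yes long = long
... | no ¬long = contradiction I-long (ℕ.≤⇒≯ (begin
  length I                            ≡⟨ cong length I≡ ⟩
  length (interleave (a t) X)         ≤⟨ length-interleave-short (a t) X i Xᵢ≤n Xⱼ≤n+D ⟩
  suc (suc l) + (n + l * (n + D))     ≡⟨ lem l n D ⟩
  suc (suc n) + l + l * (n + D)       ∎))
  where
  open ℕ.≤-Reasoning
  D : ℕ
  D = maxSegmentSum t
  Xᵢ≤n : length (X i) ≤ n
  Xᵢ≤n = s≤s⁻¹ (ℕ.≰⇒> ¬long)
  Xⱼ≤n+D : ∀ j → length (X j) ≤ n + D
  Xⱼ≤n+D j = ℕ.≤-trans (length-diff t X ψ-diff i j) (ℕ.+-monoˡ-≤ D Xᵢ≤n)
  lem : ∀ l n D → suc (suc l) + (n + l * (n + D)) ≡ suc (suc n) + l + l * (n + D)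
  lem = ℕ-Solver.solve-∀

-- Here k ≥ 2 enters: `l` ≥ 1 supplies, besides the leading N, one more summand N - 2 and one more
-- letter.
twice-bound<length : ∀ n l {D i} → 1 ≤ l → suc (suc n) + l + l * (n + D) < i → suc n + suc n < i
twice-bound<length n (suc l) {D} {i} _ i-long = begin-strict
  suc n + suc n                                              ≤⟨ ℕ.m≤m+n (suc n + suc n) _ ⟩
  suc n + suc n + suc (l + D + l * (n + D))                  ≡⟨ lem n l D ⟩
  suc (suc n) + suc l + suc l * (n + D)                      <⟨ i-long ⟩
  i                                                          ∎
  where
  open ℕ.≤-Reasoning
  lem : ∀ n l D → suc n + suc n + suc (l + D + l * (n + D)) ≡ suc (suc n) + suc l + suc l * (n + D)
  lem = ℕ-Solver.solve-∀

-- If i ≤ j, then 2i ≤ 2j ≤ i + 2B < 2i.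
<-from-double : ∀ {i j p q B} → j + j ≤ p + (i + q) → p ≤ B → q ≤ B → B + B < i → j < i
<-from-double {i} {j} {p} {q} {B} 2j≤ p≤B q≤B 2B<i = ℕ.≰⇒> λ i≤j → ℕ.<-irrefl refl (begin-strict
  i + i          ≤⟨ ℕ.+-mono-≤ i≤j i≤j ⟩
  j + j          ≤⟨ 2j≤ ⟩
  p + (i + q)    ≤⟨ ℕ.+-mono-≤ p≤B (ℕ.+-monoʳ-≤ i q≤B) ⟩
  B + (i + B)    ≡⟨ lem B i ⟩
  i + (B + B)    <⟨ ℕ.+-monoʳ-< i 2B<i ⟩
  i + i          ∎)
  where
  open ℕ.≤-Reasoning
  lem : ∀ B i → B + (i + B) ≡ i + (B + B)
  lem = ℕ-Solver.solve-∀

-- The parent template and its instance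

module _ {m} {h : Word m → Word m} (hom : IsMorphism h) {B} (h-bound : ∀ y → length (h [ y ]) ≤ suc B)
         {l} (t : Template m l) {I W L R : Word m} (inst : I InstanceOf t)
         (P : Parse hom h-bound (a t) (proj₁ inst) W L R) where

  open IsMonoidHomomorphism hom using (homo)
  open Parse P

  private
    X : Vector (Word m) (suc l)
    X = proj₁ inst

  -- The vectors `d` are read off from the inner words `Y`, so that `J` is an instance by
  -- construction and only the parent equation needs proof.
  parent : Template m l
  parent = record { a = A ; d = λ j → ψℤ (Y (suc j)) -ᵥ ψℤ (Y (inject₁ j)) }

  -- By `X-split`, ψ(X_i) is ψ(p″_i p′_{i+1}) plus ψ(h(Y_i)) = ψ(Y_i)M. Subtracting this for
  -- consecutive indices gives the equation.
  parent-isParent : IsParent h parent t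
  parent-isParent = p′ , p″ , A-image , eq
    where
    ψX : ∀ i c → ψℤ (X i) c ≡ ψℤ (p″ (inject₁ i) ++ p′ (suc i)) c ℤ.+ ψℤ (h (Y i)) c
    ψX i c = begin
      ψℤ (X i) c                                        ≡⟨ cong (λ u → ψℤ u c) (X-split i) ⟩
      ψℤ (p ++ h (Y i) ++ q) c                          ≡⟨ ψℤ-++ p (h (Y i) ++ q) c ⟩
      ψℤ p c ℤ.+ ψℤ (h (Y i) ++ q) c                    ≡⟨ cong (λ z → ψℤ p c ℤ.+ z) (ψℤ-++ (h (Y i)) q c) ⟩
      ψℤ p c ℤ.+ (ψℤ (h (Y i)) c ℤ.+ ψℤ q c)            ≡⟨ lem (ψℤ p c) (ψℤ (h (Y i)) c) (ψℤ q c) ⟩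
      (ψℤ p c ℤ.+ ψℤ q c) ℤ.+ ψℤ (h (Y i)) c            ≡⟨ cong (λ z → z ℤ.+ ψℤ (h (Y i)) c) (ψℤ-++ p q c) ⟨
      ψℤ (p ++ q) c ℤ.+ ψℤ (h (Y i)) c                  ∎
      where
      open ≡-Reasoning
      p q : Word m
      p = p″ (inject₁ i)
      q = p′ (suc i)
      lem : ∀ x y z → x ℤ.+ (y ℤ.+ z) ≡ (x ℤ.+ z) ℤ.+ y
      lem = ℤ-Solver.solve-∀
    eq : ∀ j c → (ψℤ (p″ (inject₁ (suc j)) ++ p′ (suc (suc j))) -ᵥ ψℤ (p″ (inject₁ (inject₁ j)) ++ p′ (inject₁ (suc j)))
                    +ᵥ d parent j *ᵥ frequencyMatrix h) c ≡ d t j c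
    eq j c = begin
      u₁ ℤ.- u₀ ℤ.+ (d parent j *ᵥ frequencyMatrix h) c
        ≡⟨ cong (λ z → u₁ ℤ.- u₀ ℤ.+ z)
             (trans (∙-distribʳ-- (λ r → frequencyMatrix h r c) (ψℤ (Y (suc j))) (ψℤ (Y (inject₁ j))))
                    (cong₂ ℤ._-_ (ψℤ*frequencyMatrix hom (Y (suc j)) c) (ψℤ*frequencyMatrix hom (Y (inject₁ j)) c))) ⟩
      u₁ ℤ.- u₀ ℤ.+ (v₁ ℤ.- v₀)
        ≡⟨ lem u₁ u₀ v₁ v₀ ⟩
      (u₁ ℤ.+ v₁) ℤ.- (u₀ ℤ.+ v₀)
        ≡⟨ cong₂ ℤ._-_ (ψX (suc j) c) (ψX (inject₁ j) c) ⟨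
      ψℤ (X (suc j)) c ℤ.- ψℤ (X (inject₁ j)) c
        ≡⟨ proj₂ (proj₂ inst) j c ⟩
      d t j c ∎
      where
      open ≡-Reasoning
      u₁ u₀ v₁ v₀ : ℤ
      u₁ = ψℤ (p″ (inject₁ (suc j)) ++ p′ (suc (suc j))) c
      u₀ = ψℤ (p″ (inject₁ (inject₁ j)) ++ p′ (inject₁ (suc j))) c
      v₁ = ψℤ (h (Y (suc j))) c
      v₀ = ψℤ (h (Y (inject₁ j))) c
      lem : ∀ a b c d → a ℤ.- b ℤ.+ (c ℤ.- d) ≡ (a ℤ.+ c) ℤ.- (b ℤ.+ d)
      lem = ℤ-Solver.solve-∀

  J : Word m
  J = interleave A Y

  J-instance : J InstanceOf parent
  J-instance = Y , refl , λ _ _ → refl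

  J-factor : ∀ {w} → W PrefixOf w → J FactorOf w
  J-factor {w} oW = length Q , occursAt-++ˡ {w = w} J (occursAt-++ʳ {w = w} {q = 0} Q (subst (_PrefixOf w) W-split oW))

  -- Both factorizations of `h W` begin with `h Q` and end with `h S`; cancelling these leaves `I`
  -- with the two outer overhangs.
  h-J : h W ≡ L ++ I ++ R → h J ≡ p′ zero ++ I ++ p″ (fromℕ (suc l))
  h-J e = ++-cancelʳ (h S) (h J) (p′ zero ++ I ++ last) (++-cancelˡ (h Q) _ _ (begin
    h Q ++ h J ++ h S                            ≡⟨ cong (h Q ++_) (homo J S) ⟨
    h Q ++ h (J ++ S)                            ≡⟨ homo Q (J ++ S) ⟨
    h (Q ++ J ++ S)                              ≡⟨ cong h W-split ⟨
    h W                                          ≡⟨ e ⟩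
    L ++ I ++ R                                  ≡⟨ cong₂ (λ u v → u ++ I ++ v) L-split R-split ⟩
    (h Q ++ p′ zero) ++ I ++ last ++ h S         ≡⟨ ++-assoc (h Q) (p′ zero) _ ⟩
    h Q ++ p′ zero ++ I ++ last ++ h S           ≡⟨ cong (λ u → h Q ++ p′ zero ++ u) (++-assoc I last (h S)) ⟨
    h Q ++ p′ zero ++ (I ++ last) ++ h S         ≡⟨ cong (h Q ++_) (++-assoc (p′ zero) (I ++ last) (h S)) ⟨
    h Q ++ (p′ zero ++ I ++ last) ++ h S         ∎))
    where
    open ≡-Reasoning
    last : Word m
    last = p″ (fromℕ (suc l))

  J-shorter : (∀ i → 1 < length (h [ i ])) → h W ≡ L ++ I ++ R → B + B < length I → length J < length I
  J-shorter growing e 2B<I =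
    <-from-double
      (subst (length J + length J ≤_)
        (trans (cong length (h-J e))
          (trans (length-++ (p′ zero)) (cong (λ n → length (p′ zero) + n) (length-++ I))))
        (length-doubles hom growing J))
      first-bound last-bound 2B<I

-- Descent from factors of the limit word

module _ {m} {h : Word m → Word m} (hom : IsMorphism h) (growing : ∀ i → 1 < length (h [ i ]))
         {σ w} (limit : Is-hω h σ w) where

  factor-in-image : ∀ {u} → u FactorOf w →
                    ∃[ W ] ∃[ L ] ∃[ R ] (W PrefixOf w × h W ≡ L ++ u ++ R)
  factor-in-image {u} (p , o) =
    -- The iterate of index `suc n` is longer than `n`, so it covers the occurrence of `u`; it is
    -- the image of the iterate of index `n`, which serves as `W`.
    let n = p + length u
        L , R , e = factor-of-long-prefix {w = w} {p = p} {u = u} o (limit (suc n)) (ℕ.<⇒≤ (ℕ.<-trans (ℕ.n<1+n n) (length-iter hom growing σ (suc n))))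
    in iter h n [ σ ] , L , R , limit n , e

  -- Writing N as n + 2 keeps truncated subtraction out of the argument.
  shorter-parent-instance :
    ∀ n → (∀ y → length (h [ y ]) ≤ suc (suc n)) →
    ∀ {l} → 1 ≤ l → (t : Template m l) (I : Word m) → I FactorOf w → I InstanceOf t →
    suc (suc n) + l + l * (n + maxSegmentSum t) < length I →
    ∃[ t₁ ] (IsParent h t₁ t × ∃[ J ] (J FactorOf w × J InstanceOf t₁ × length J < length I))
  shorter-parent-instance n h-bound {l} 1≤l t I factor inst@(X , I≡ , _) I-long
    with W , L , R , W-prefix , hW≡ ← factor-in-image {u = I} factor =
    parent hom h-bound t inst P , parent-isParent hom h-bound t inst P ,
    J hom h-bound t inst P , J-factor hom h-bound t inst P {w = w} W-prefix , J-instance hom h-bound t inst P ,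
    J-shorter hom h-bound t inst P growing hW≡ (twice-bound<length n l 1≤l I-long)
    where
    P : Parse hom h-bound (a t) X W L R
    P = parse hom h-bound (a t) X W L R (all-pieces-long t inst I-long)
          (trans hW≡ (cong (λ u → L ++ u ++ R) I≡))

lemma3p5 : (m-1 : ℕ) (h : Word (suc m-1) → Word (suc m-1)) → IsMorphism h →
    (x : Word (suc m-1)) → x ≢ [] → h [ zero ] ≡ zero ∷ x →
    (∀ (i : Fin (suc m-1)) → length (h [ i ]) > 1) →
    (hω : InfiniteWord (suc m-1)) → Is-hω h zero hω →
    (k-1 : ℕ) → 2 ≤ suc k-1 →
    (t : Template (suc m-1) k-1) (I : Word (suc m-1)) →
    I FactorOf hω → I InstanceOf t →
    length I > maxImageLength h + k-1 + k-1 * ((maxImageLength h ∸ 2) + maxSegmentSum t) →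
    ∃[ t₁ ] (IsParent h t₁ t × ∃[ J ] (J FactorOf hω × J InstanceOf t₁ × length J < length I))
lemma3p5 m-1 h hom x _ _ growing hω limit k-1 2≤k t I factor inst I-long =
  shorter-parent-instance hom growing {w = hω} limit (maxImageLength h ∸ 2)
    (λ y → subst (length (h [ y ]) ≤_) (sym N≡) (length-image≤max h y))
    (s≤s⁻¹ 2≤k) t I factor inst
    (subst (λ N → N + k-1 + k-1 * ((maxImageLength h ∸ 2) + maxSegmentSum t) < length I) (sym N≡) I-long)
  where
  -- The image of the first letter has length at least 2, hence N ≥ 2 and the truncated N - 2 is the
  -- true difference.
  N≡ : suc (suc (maxImageLength h ∸ 2)) ≡ maxImageLength h
  N≡ = ℕ.m+[n∸m]≡n (ℕ.≤-trans (growing zero) (length-image≤max h zero))
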